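{- Let $\mathcal{G}=(V,E,\lambda)$ be a happy compressed temporal graph with $|V|\ge 2$ that is temporally connected and minimal. Then for each vertex $v\in V$ there is exactly one divergent edge $e$ with $v\leadsto e$, and for each vertex $v\in V$ there is exactly one convergent edge $e$ with $e\leadsto v$.
   Context: A happy temporal graph is a triple $\mathcal{G}=(V,E,\lambda)$ where $(V,E)$ is a finite simple undirected graph (the footprint) and $\lambda:E\to\{1,2,3,\dots\}$ assigns a single time label to each edge, such that two distinct edges sharing an endpoint have different labels. It is compressed if for every edge $e$ with $\lambda(e)>1$ there is an edge $e'$ adjacent to $e$ with $\lambda(e')=\lambda(e)-1$. A temporal walk is a walk in the footprint along which edge labels are strictly increasing (so no edge is repeated); the empty walk is allowed. For vertices $u,v$ and edges $e,e'$: $u\leadsto v$ means there is a temporal walk from $u$ to $v$; $v\leadsto e$ means some temporal walk starts at $v$ and traverses $e$; $e\leadsto v$ means some temporal walk traverses $e$ and ends at $v$; $e\leadsto e'$ means some temporal walk traverses $e$ and $e'$ in this order, not necessarily consecutively (with $e\leadsto e$ always). Edges may be traversed in either direction. $\mathcal{G}$ is temporally connected if $u\leadsto v$ for all $u,v\in V$. The reachability graph $\mathcal{R}(\mathcal{G})$ is the directed graph on $V$ with arcs $(u,v)$ whenever $u\leadsto v$; $\mathcal{G}$ is minimal if $\mathcal{R}(\mathcal{G}\setminus\{e\})\ne\mathcal{R}(\mathcal{G})$ for every $e\in E$ (deleting $e$, keeping all vertices and the other labelled edges). An edge $e$ is a source edge if $e\leadsto v$ for all $v\in V$, and a sink edge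 if $v\leadsto e$ for all $v\in V$. A divergent edge is a source edge $e$ such that there is no other source edge $e'\neq e$ with $e\leadsto e'$. A div-sink edge is a sink edge $e$ such that $d\leadsto e$ for every divergent edge $d$. A convergent edge is a div-sink edge $e$ such that there is no other div-sink edge $e'\ne e$ with $e'\leadsto e$. -}

module Defs where

open import Data.Fin using (Fin; _<_; punchIn)
open import Data.Fin.Properties using (punchIn-injective)
open import Data.List using (List; []; _∷_; map)
open import Data.List.Membership.Propositional using (_∈_)
open import Data.List.Relation.Binary.Sublist.Propositional using (_⊆_)
open import Data.List.Relation.Unary.Linked using (Linked)
open import Data.Nat as ℕ using (ℕ; suc; pred; _≤_; _∸_)
open import Data.Product using (Σ-syntax; ∃-syntax; _×_; _,_; proj₁; proj₂)
open import Data.Sum using (_⊎_)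
open import Function using (_∘_)
open import Function.Definitions using (Injective)
open import Relation.Binary using (Rel; _⇔_)
open import Relation.Binary.PropositionalEquality using (_≡_; _≢_)
open import Relation.Nullary using (¬_)
open import Level using (0ℓ)

-- The vertex set is Fin n and the edge set is Fin m.  An undirected edge is
-- stored once, as the pair of its endpoints in increasing order: `ordered`
-- excludes loops and, together with it, `simple` excludes parallel edges.
record TemporalGraph (n m : ℕ) : Set where
  field
    ends      : Fin m → Fin n × Fin n
    ordered   : ∀ e → proj₁ (ends e) < proj₂ (ends e)
    simple    : Injective _≡_ _≡_ ends
    label     : Fin m → ℕ
    label-pos : ∀ e → 1 ≤ label e

open TemporalGraph public

private
  variable
    n m : ℕ

Joins : TemporalGraph n m → Fin m → Fin n → Fin n → Set
Joins G e u v = ends G e ≡ (u , v) ⊎ ends G e ≡ (v , u)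

Endpoint : TemporalGraph n m → Fin m → Fin n → Set
Endpoint G e v = proj₁ (ends G e) ≡ v ⊎ proj₂ (ends G e) ≡ v

Adjacent : TemporalGraph n m → Rel (Fin m) 0ℓ
Adjacent G e e′ = e ≢ e′ × ∃[ v ] (Endpoint G e v × Endpoint G e′ v)

Happy : TemporalGraph n m → Set
Happy G = ∀ e e′ → Adjacent G e e′ → label G e ≢ label G e′

Compressed : TemporalGraph n m → Set
Compressed G = ∀ e → 1 ℕ.< label G e →
  ∃[ e′ ] (Adjacent G e e′ × label G e′ ≡ label G e ∸ 1)

data Walk (G : TemporalGraph n m) : Fin n → Fin n → Set where
  nil  : ∀ {u} → Walk G u u
  step : ∀ {u v w} (e : Fin m) → Joins G e u v → Walk G v w → Walk G u w

edges : {G : TemporalGraph n m} {u v : Fin n} → Walk G u v → List (Fin m)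
edges nil          = []
edges (step e _ w) = e ∷ edges w

-- `Linked` relates consecutive entries only; as < is transitive, this is the
-- same as the whole label sequence being strictly increasing.
Temporal : {G : TemporalGraph n m} {u v : Fin n} → Walk G u v → Set
Temporal {G = G} w = Linked ℕ._<_ (map (label G) (edges w))

-- In the four reachability relations, a superscript e marks the side of the
-- arrow on which an edge (rather than a vertex) stands.
infix 4 _⊢_⇝_ _⊢_⇝ᵉ_ _⊢_ᵉ⇝_ _⊢_ᵉ⇝ᵉ_

_⊢_⇝_ : TemporalGraph n m → Fin n → Fin n → Set
G ⊢ u ⇝ v = Σ[ w ∈ Walk G u v ] Temporal w

_⊢_⇝ᵉ_ : TemporalGraph n m → Fin n → Fin m → Set
G ⊢ v ⇝ᵉ e = ∃[ x ] Σ[ w ∈ Walk G v x ] (Temporal w × e ∈ edges w)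

_⊢_ᵉ⇝_ : TemporalGraph n m → Fin m → Fin n → Set
G ⊢ e ᵉ⇝ v = ∃[ x ] Σ[ w ∈ Walk G x v ] (Temporal w × e ∈ edges w)

-- The sublist order _⊆_ keeps the order of entries but may skip some, so the
-- walk traverses e and later e′, not necessarily consecutively.
_⊢_ᵉ⇝ᵉ_ : TemporalGraph n m → Fin m → Fin m → Set
G ⊢ e ᵉ⇝ᵉ e′ = e ≡ e′ ⊎
  (∃[ x ] ∃[ y ] Σ[ w ∈ Walk G x y ] (Temporal w × (e ∷ e′ ∷ []) ⊆ edges w))

TemporallyConnected : TemporalGraph n m → Set
TemporallyConnected G = ∀ u v → G ⊢ u ⇝ v

-- The arc relation of the reachability graph.
Reachability : TemporalGraph n m → Rel (Fin n) 0ℓ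
Reachability G u v = G ⊢ u ⇝ v

-- Deleting e re-indexes the remaining edges along punchIn e, which enumerates
-- the edges other than e.
infixl 6 _∖_
_∖_ : TemporalGraph n m → Fin m → TemporalGraph n (pred m)
_∖_ {m = suc _} G e = record
  { ends      = ends G ∘ punchIn e
  ; ordered   = ordered G ∘ punchIn e
  ; simple    = punchIn-injective e _ _ ∘ simple G
  ; label     = label G ∘ punchIn e
  ; label-pos = label-pos G ∘ punchIn e
  }

-- Equality of reachability graphs is equality of arc sets, expressed by mutual
-- inclusion of relations.
Minimal : TemporalGraph n m → Set
Minimal G = ∀ e → ¬ (Reachability (G ∖ e) ⇔ Reachability G)

SourceEdge : TemporalGraph n m → Fin m → Set
SourceEdge G e = ∀ v → G ⊢ e ᵉ⇝ v

SinkEdge : TemporalGraph n m → Fin m → Set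
SinkEdge G e = ∀ v → G ⊢ v ⇝ᵉ e

Divergent : TemporalGraph n m → Fin m → Set
Divergent G e = SourceEdge G e ×
  ¬ (∃[ e′ ] (SourceEdge G e′ × e′ ≢ e × G ⊢ e ᵉ⇝ᵉ e′))

DivSink : TemporalGraph n m → Fin m → Set
DivSink G e = SinkEdge G e × (∀ d → Divergent G d → G ⊢ d ᵉ⇝ᵉ e)

Convergent : TemporalGraph n m → Fin m → Set
Convergent G e = DivSink G e ×
  ¬ (∃[ e′ ] (DivSink G e′ × e′ ≢ e × G ⊢ e′ ᵉ⇝ᵉ e))

{-# OPTIONS --safe #-}

-- Write e ≼ f when f is reached from e through consecutively adjacent edges
-- with increasing labels.  All reachability relations can be expressed through
-- ≼, and the edges at a vertex form a chain.  The crux: for no edge x can both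
-- endpoints carry a later source edge, as deleting x would then preserve
-- connectivity: a walk about to use x at one of its endpoints continues there
-- with the later source edge instead.  So the source edges above a
-- given edge never branch, and at most one divergent edge lies above it.
-- Reversing time, the same argument applies to div-sink edges, since these are
-- upward closed sink edges.
module Submission where

open import Defs
open import Data.Nat as ℕ using (ℕ; suc; _≤_; s≤s)
import Data.Nat.Properties as ℕ
open import Data.Fin using (Fin; zero; suc; punchIn; punchOut)
open import Data.Fin.Properties using (_≟_; any?; all?; punchIn-injective; punchIn-punchOut; punchInᵢ≢i)
open import Data.Fin.Induction using (spo-wellFounded; spo-noetherian)
open import Data.List using ([]; _∷_; map)
open import Data.List.Membership.Propositional using (_∈_)
open import Data.List.Relation.Binary.Sublist.Propositional using (_⊆_; _∷_; _∷ʳ_; from∈; to∈)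
open import Data.List.Relation.Unary.Any using (here; there)
open import Data.List.Relation.Unary.Linked as Linked using (Linked; [-]; _∷_)
open import Data.Product using (Σ-syntax; ∃; ∃₂; ∃-syntax; ∃!; _×_; _,_; proj₁; proj₂)
open import Data.Sum using (_⊎_; inj₁; inj₂; swap)
open import Function using (flip; _on_; _∘_)
open import Induction.WellFounded using (Acc; acc; WellFounded)
open import Level using (0ℓ)
open import Relation.Binary using (Rel; Decidable; IsStrictPartialOrder; tri<; tri≈; tri>; _⇔_)
import Relation.Binary.Construct.Flip.EqAndOrd as Flip
open import Relation.Binary.Construct.Closure.ReflexiveTransitive using (Star; ε; _◅_; _◅◅_; reverse)
open import Relation.Binary.PropositionalEquality using (_≡_; _≢_; refl; sym; trans; cong; subst; ≢-sym; isEquivalence)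
open import Relation.Nullary using (¬_; Dec; yes; no; contradiction)
open import Relation.Nullary.Decidable using (map′; ¬?; _×-dec_; _⊎-dec_; _→-dec_)
import Relation.Unary as Unary

private
  variable
    n m : ℕ

-- Minimal elements and transport of unique existence.

minimalElement : {_⊏_ : Rel (Fin m) 0ℓ} → WellFounded _⊏_ → Decidable _⊏_ →
  {P : Fin m → Set} → Unary.Decidable P → ∃ P →
  ∃[ d ] (P d × (∀ {e} → P e → ¬ e ⊏ d))
minimalElement {_⊏_ = _⊏_} wf _⊏?_ {P} P? (e₀ , p₀) = descend (wf e₀) p₀
  where
  descend : ∀ {e} → Acc _⊏_ e → P e → ∃[ d ] (P d × (∀ {e} → P e → ¬ e ⊏ d))
  descend {e} (acc rs) p with any? (λ f → P? f ×-dec (f ⊏? e))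
  ... | yes (f , q , f⊏e) = descend (rs f⊏e) q
  ... | no none           = e , p , λ q f⊏e → none (_ , q , f⊏e)

∃!-resp : {A : Set} {P Q : A → Set} → (∀ {x} → P x → Q x) → (∀ {x} → Q x → P x) →
  ∃! _≡_ P → ∃! _≡_ Q
∃!-resp P⇒Q Q⇒P (x , p , unique) = x , P⇒Q p , unique ∘ Q⇒P

-- Endpoints of an edge.

module _ {n m} (G : TemporalGraph n m) where

  endpoint? : ∀ e v → Dec (Endpoint G e v)
  endpoint? e v = (proj₁ (ends G e) ≟ v) ⊎-dec (proj₂ (ends G e) ≟ v)

  joinsˡ : ∀ {e u v} → Joins G e u v → Endpoint G e u
  joinsˡ (inj₁ p) = inj₁ (cong proj₁ p)
  joinsˡ (inj₂ p) = inj₂ (cong proj₂ p)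

  joins-sym : ∀ {e u v} → Joins G e u v → Joins G e v u
  joins-sym = swap

  joinsʳ : ∀ {e u v} → Joins G e u v → Endpoint G e v
  joinsʳ {e} = joinsˡ {e} ∘ joins-sym {e}

  opposite : ∀ {e u} → Endpoint G e u → ∃[ v ] Joins G e u v
  opposite {e} (inj₁ p) = _ , inj₁ (cong (_, proj₂ (ends G e)) p)
  opposite {e} (inj₂ p) = _ , inj₂ (cong (proj₁ (ends G e) ,_) p)

  endpoint⇒joins : ∀ {e u v} → Endpoint G e u → Endpoint G e v → u ≢ v → Joins G e u v
  endpoint⇒joins (inj₁ p) (inj₁ q) u≢v = contradiction (trans (sym p) q) u≢v
  endpoint⇒joins (inj₂ p) (inj₂ q) u≢v = contradiction (trans (sym p) q) u≢v
  endpoint⇒joins {e} (inj₁ refl) (inj₂ refl) _ = inj₁ refl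
  endpoint⇒joins {e} (inj₂ refl) (inj₁ refl) _ = inj₂ refl

  third-endpoint : ∀ {e u v w} → Endpoint G e u → Endpoint G e v → u ≢ v →
    Endpoint G e w → w ≡ u ⊎ w ≡ v
  third-endpoint {e} e∋u e∋v u≢v e∋w with endpoint⇒joins {e} e∋u e∋v u≢v | e∋w
  ... | inj₁ refl | inj₁ p = inj₁ (sym p)
  ... | inj₁ refl | inj₂ p = inj₂ (sym p)
  ... | inj₂ refl | inj₁ p = inj₂ (sym p)
  ... | inj₂ refl | inj₂ p = inj₁ (sym p)

-- Chains of adjacent edges, over an abstract order so that both time directions are covered.

module Chains {n m} (G : TemporalGraph n m) (_≺_ : Rel (Fin m) 0ℓ) where

  Step : Rel (Fin m) 0ℓ
  Step e f = e ≺ f × ∃[ v ] (Endpoint G e v × Endpoint G f v)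

  infix 4 _≼_
  _≼_ : Rel (Fin m) 0ℓ
  _≼_ = Star Step

  -- For the label order these are the source edges, for the reversed order the sink edges.
  Universal : Fin m → Set
  Universal e = ∀ v → ∃[ f ] (Endpoint G f v × e ≼ f)

  -- The case `u = v` is included, so every vertex carries an edge.
  Connected : Set
  Connected = ∀ u v → ∃₂ λ e f → Endpoint G e u × Endpoint G f v × e ≼ f

  AvoidingStep : Fin m → Rel (Fin m) 0ℓ
  AvoidingStep x e f = Step e f × e ≢ x × f ≢ x

  -- Connectivity after deleting `x`, phrased on the original edge set so that no chain has to be
  -- re-indexed.
  ConnectedWithout : Fin m → Set
  ConnectedWithout x = ∀ u v → ∃₂ λ e f →
    Endpoint G e u × Endpoint G f v × e ≢ x × f ≢ x × Star (AvoidingStep x) e f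

  module Ordered
    (isSPO : IsStrictPartialOrder _≡_ _≺_) (_≺?_ : Decidable _≺_)
    -- Happiness supplies this in both time directions: edges at a common vertex have distinct
    -- labels.
    (compare : ∀ {v e f} → Endpoint G e v → Endpoint G f v → e ≢ f → e ≺ f ⊎ f ≺ e)
    where

    open IsStrictPartialOrder isSPO using (irrefl) renaming (trans to ≺-trans)

    step? : Decidable Step
    step? e f = (e ≺? f) ×-dec any? (λ v → endpoint? G e v ×-dec endpoint? G f v)

    -- Every step strictly ascends in a finite strict order, so an exhaustive search over the next
    -- edge terminates.
    _≼?_ : Decidable _≼_
    e ≼? f = decide (spo-noetherian isSPO e)
      where
      decide : ∀ {e} → Acc (flip _≺_) e → Dec (e ≼ f)
      decide {e} (acc rs) with e ≟ f
      ... | yes refl = yes ε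
      ... | no e≢f   =
        map′ (λ (_ , s , c) → s ◅ c)
             (λ { ε → contradiction refl e≢f ; (s ◅ c) → _ , s , c })
             (any? via)
        where
        via : ∀ g → Dec (Step e g × g ≼ f)
        via g with step? e g
        ... | yes s = map′ (s ,_) proj₂ (decide (rs (proj₁ s)))
        ... | no ¬s = no (¬s ∘ proj₁)

    universal? : Unary.Decidable Universal
    universal? e = all? λ v → any? λ f → endpoint? G f v ×-dec (e ≼? f)

    ≺⇒≢ : ∀ {e f} → e ≺ f → f ≢ e
    ≺⇒≢ e≺f f≡e = irrefl (sym f≡e) e≺f

    ≼⇒≺ : ∀ {e f} → f ≢ e → e ≼ f → e ≺ f
    ≼⇒≺ f≢e ε = contradiction refl f≢e
    ≼⇒≺ {f = f} _ (_◅_ {j = g} (e≺g , _) c) with f ≟ g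
    ... | yes refl = e≺g
    ... | no f≢g   = ≺-trans e≺g (≼⇒≺ f≢g c)

    -- A minimal edge at `v` is least there by comparability, and a single step through `v` leads
    -- from it to any other edge at `v`.
    first : Connected → ∀ v → ∃[ e ] (Endpoint G e v × (∀ {f} → Endpoint G f v → e ≼ f))
    first connected v
      with minimalElement (spo-wellFounded isSPO) _≺?_ (λ e → endpoint? G e v)
             (let e , _ , e∋v , _ = connected v v in e , e∋v)
    ... | e , e∋v , least = e , e∋v , below
      where
      below : ∀ {f} → Endpoint G f v → e ≼ f
      below {f} f∋v with e ≟ f
      ... | yes refl = ε
      ... | no e≢f with compare e∋v f∋v e≢f
      ...   | inj₁ e≺f = (e≺f , v , e∋v , f∋v) ◅ ε
      ...   | inj₂ f≺e = contradiction f≺e (least f∋v)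

    -- A chain to `w` leaves `v` by some edge at `v`; the least edge at `v` can be put in front of
    -- it.
    first-universal : Connected → ∀ {v e} → (∀ {f} → Endpoint G f v → e ≼ f) → Universal e
    first-universal connected {v} below w =
      let _ , g , f∋v , g∋w , c = connected v w in g , g∋w , below f∋v ◅◅ c

    -- A chain only ascends, so once beyond `x` it cannot return to it.
    above-avoids : ∀ {x e f} → x ≺ e → e ≼ f → f ≢ x × Star (AvoidingStep x) e f
    above-avoids x≺e ε = ≺⇒≢ x≺e , ε
    above-avoids x≺e (s ◅ c) =
      let x≺g = ≺-trans x≺e (proj₁ s)
          f≢x , c′ = above-avoids x≺g c
      in f≢x , (s , ≺⇒≢ x≺e , ≺⇒≢ x≺g) ◅ c′

    LaterUniversal : Fin m → Fin n → Set
    LaterUniversal x v = ∃[ f ] (Endpoint G f v × x ≺ f × Universal f)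

    module _ {x} (later : ∀ {v} → Endpoint G x v → LaterUniversal x v) where

      -- The chain is followed until it is about to take `x`, then replaced by the chain of a later
      -- universal edge. Only the final vertex `v` is kept; the last edge may change.
      bypass : ∀ {e f v} → e ≢ x → e ≼ f → Endpoint G f v →
        ∃[ g ] (Endpoint G g v × g ≢ x × Star (AvoidingStep x) e g)
      bypass e≢x ε f∋v = _ , f∋v , e≢x , ε
      bypass {v = v} e≢x (_◅_ {j = g} s@(e≺g , w , e∋w , g∋w) c) f∋v with g ≟ x
      ... | no g≢x   =
        let h , h∋v , h≢x , c′ = bypass g≢x c f∋v
        in h , h∋v , h≢x , (s , e≢x , g≢x) ◅ c′
      -- Since `e ≺ x ≺ y` and all three edges meet at `w`, the turn from `e` directly onto `y` is a
      -- legal step.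
      ... | yes refl =
        let y , y∋w , x≺y , universal = later g∋w
            h , h∋v , d = universal v
            h≢x , d′ = above-avoids x≺y d
        in h , h∋v , h≢x ,
           ((≺-trans e≺g x≺y , w , e∋w , y∋w) , e≢x , ≺⇒≢ x≺y) ◅ d′

      fork-redundant : Connected → ConnectedWithout x
      fork-redundant connected u v with connected u v
      ... | e , f , e∋u , f∋v , c with e ≟ x
      ...   | no e≢x   =
        let g , g∋v , g≢x , c′ = bypass e≢x c f∋v in e , g , e∋u , g∋v , e≢x , g≢x , c′
      -- The chain starts with `x` itself, so it is replaced from the outset by that of the later
      -- universal edge at `u`.
      ...   | yes refl =
        let y , y∋u , x≺y , universal = later e∋u
            h , h∋v , d = universal v
            h≢x , d′ = above-avoids x≺y d
        in y , h , y∋u , h∋v , ≺⇒≢ x≺y , h≢x , d′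

    module _
      (connected : Connected) (minimal : ∀ x → ¬ ConnectedWithout x)
      -- `F` will be the source edges forwards and the div-sink edges backwards; downward closure in
      -- the reversed order is closure under later edges.
      {F : Fin m → Set} (F? : Unary.Decidable F)
      (closed : ∀ {e f} → e ≼ f → F f → F e) (F⇒universal : ∀ {e} → F e → Universal e)
      where

      -- The common shape of divergent and convergent edges, with chains in place of walks.
      Maximal : Fin m → Set
      Maximal d = F d × ¬ (∃[ e ] (F e × e ≢ d × d ≼ e))

      maximal-above : ∀ {e} → F e → ∃[ d ] (Maximal d × e ≼ d)
      maximal-above {e} Fe
        with minimalElement (spo-noetherian isSPO) (flip _≺?_)
               (λ d → F? d ×-dec (e ≼? d)) (e , Fe , ε)
      ... | d , (Fd , e≼d) , greatest =
        d , (Fd , λ (f , Ff , f≢d , d≼f) → greatest (Ff , e≼d ◅◅ d≼f) (≼⇒≺ f≢d d≼f)) , e≼d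

      maximal-stop : ∀ {d e} → Maximal d → F e → d ≼ e → d ≡ e
      maximal-stop {d} {e} (_ , maximal) Fe d≼e with e ≟ d
      ... | yes e≡d = sym e≡d
      ... | no e≢d  = contradiction (e , Fe , e≢d , d≼e) maximal

      -- Otherwise both ends of `x` would carry a later universal edge, making `x` redundant against
      -- minimality.
      no-fork : ∀ {x f g v w} → v ≢ w → Endpoint G x v → Endpoint G x w →
        Endpoint G f v → x ≺ f → F f → Endpoint G g w → x ≺ g → ¬ F g
      no-fork {x} {f} {g} v≢w x∋v x∋w f∋v x≺f Ff g∋w x≺g Fg =
        minimal x (fork-redundant later connected)
        where
        later : ∀ {u} → Endpoint G x u → LaterUniversal x u
        later x∋u with third-endpoint G {x} x∋v x∋w v≢w x∋u
        ... | inj₁ refl = f , f∋v , x≺f , F⇒universal Ff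
        ... | inj₂ refl = g , g∋w , x≺g , F⇒universal Fg

      -- Induction upwards on `x`: if the two chains leave `x` at different ends there is a fork,
      -- and if they leave at the same end their next edges are comparable and the common start can
      -- be moved up.
      maximal-unique : ∀ {x d d′} → Maximal d → Maximal d′ → x ≼ d → x ≼ d′ → d ≡ d′
      maximal-unique {x} {d} {d′} md md′ = go (spo-noetherian isSPO x)
        where
        go : ∀ {x} → Acc (flip _≺_) x → x ≼ d → x ≼ d′ → d ≡ d′
        go _ ε c = maximal-stop md (proj₁ md′) c
        go _ c@(_ ◅ _) ε = sym (maximal-stop md′ (proj₁ md) c)
        go (acc rs) (_◅_ {j = f} (x≺f , v , x∋v , f∋v) c) (_◅_ {j = g} (x≺g , w , x∋w , g∋w) c′)
          with v ≟ w | f ≟ g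
        ... | no v≢w   | _        =
          -- Closure carries `F` from `d` and `d′` down to the edges `f` and `g` that follow `x`.
          contradiction (closed c′ (proj₁ md′))
            (no-fork v≢w x∋v x∋w f∋v x≺f (closed c (proj₁ md)) g∋w x≺g)
        ... | yes _    | yes refl = go (rs x≺f) c c′
        ... | yes refl | no f≢g with compare f∋v g∋w f≢g
        -- The earlier of the two edges becomes the new common start: it reaches the other through
        -- `v`.
        ...   | inj₁ f≺g = go (rs x≺f) c ((f≺g , v , f∋v , g∋w) ◅ c′)
        ...   | inj₂ g≺f = go (rs x≺g) ((g≺f , v , g∋w , f∋v) ◅ c) c′

      -- Whatever is reached from `v` is reached from its least edge, so it suffices to have
      -- uniqueness above that one edge.
      ∃!-maximal : (∀ {v e} → Endpoint G e v → (∀ {f} → Endpoint G f v → e ≼ f) → F e) →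
        ∀ v → ∃! _≡_ λ d → Maximal d × ∃[ e ] (Endpoint G e v × e ≼ d)
      ∃!-maximal first⇒F v =
        let e , e∋v , below = first connected v
            d , md , e≼d = maximal-above (first⇒F e∋v below)
        in d , (md , e , e∋v , e≼d) ,
           λ (md′ , _ , f∋v , f≼d′) → maximal-unique md md′ e≼d (below f∋v ◅◅ f≼d′)

-- The two time directions, and temporal walks versus chains.

module Forward {n m} (G : TemporalGraph n m) = Chains G (ℕ._<_ on label G)
module Backward {n m} (G : TemporalGraph n m) = Chains G (flip (ℕ._<_ on label G))

module Reachability⇔Chains {n m} (G : TemporalGraph n m) where
  open Forward G

  step-by : ∀ {e f v} → label G e ℕ.< label G f → Endpoint G e v → Endpoint G f v → Step e f
  step-by e<f e∋v f∋v = e<f , _ , e∋v , f∋v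

  first≼ : ∀ {u v x e f} (j : Joins G e u x) (w : Walk G x v) →
    Temporal (step {G = G} e j w) → f ∈ edges (step {G = G} e j w) → e ≼ f
  first≼ j w t (here refl) = ε
  first≼ {e = e} j (step g k w) (e<g ∷ t) (there i) =
    step-by e<g (joinsʳ G {e} j) (joinsˡ G {g} k) ◅ first≼ k w t i

  ≼last : ∀ {u v x e} (j : Joins G e u x) (w : Walk G x v) →
    Temporal (step {G = G} e j w) → ∃[ f ] (Endpoint G f v × e ≼ f)
  ≼last {e = e} j nil t = e , joinsʳ G {e} j , ε
  ≼last {e = e} j (step g k w) (e<g ∷ t) =
    let f , f∋v , c = ≼last k w t
    in f , f∋v , step-by e<g (joinsʳ G {e} j) (joinsˡ G {g} k) ◅ c

  ⇝⇒≼ : ∀ {u v} → u ≢ v → G ⊢ u ⇝ v → ∃₂ λ e f → Endpoint G e u × Endpoint G f v × e ≼ f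
  ⇝⇒≼ u≢v (nil , _) = contradiction refl u≢v
  ⇝⇒≼ _ (step e j w , t) = let f , f∋v , c = ≼last j w t in e , f , joinsˡ G {e} j , f∋v , c

  ⇝ᵉ⇒≼ : ∀ {v e} → G ⊢ v ⇝ᵉ e → ∃[ f ] (Endpoint G f v × f ≼ e)
  ⇝ᵉ⇒≼ (_ , step f j w , t , i) = f , joinsˡ G {f} j , first≼ j w t i

  ᵉ⇝⇒≼ : ∀ {v e} → G ⊢ e ᵉ⇝ v → ∃[ f ] (Endpoint G f v × e ≼ f)
  ᵉ⇝⇒≼ (_ , w , t , i) = go w t i
    where
    go : ∀ {u v e} (w : Walk G u v) → Temporal w → e ∈ edges w →
      ∃[ f ] (Endpoint G f v × e ≼ f)
    go (step _ j w) t (here refl) = ≼last j w t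
    go (step _ _ w) t (there i)   = go w (Linked.tail t) i

  ᵉ⇝ᵉ⇒≼ : ∀ {e f} → G ⊢ e ᵉ⇝ᵉ f → e ≼ f
  ᵉ⇝ᵉ⇒≼ (inj₁ refl) = ε
  ᵉ⇝ᵉ⇒≼ (inj₂ (_ , _ , w , t , s)) = go w t s
    where
    go : ∀ {x y e f} (w : Walk G x y) → Temporal w → (e ∷ f ∷ []) ⊆ edges w → e ≼ f
    go (step _ _ w) t (_ ∷ʳ s)   = go w (Linked.tail t) s
    go (step _ j w) t (refl ∷ s) = first≼ j w t (there (to∈ s))

  -- The lower bound acts as a virtual label in front, so prefixing an edge to a walk is one more
  -- link.
  StartsAfter : ℕ → {u v : Fin n} → Walk G u v → Set
  StartsAfter k w = Linked ℕ._<_ (k ∷ map (label G) (edges w))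

  -- A chain need not be a walk: when it turns from e to g at the vertex where the
  -- walk already stands, the walk omits e.
  walk-between : ∀ {e f u v k} → e ≼ f → Endpoint G e u → Endpoint G f v → k ℕ.< label G e →
    Σ[ w ∈ Walk G u v ] StartsAfter k w
  walk-between {e} {u = u} {v} ε e∋u e∋v k<e with u ≟ v
  ... | yes refl = nil , [-]
  ... | no u≢v   = step e (endpoint⇒joins G {e} e∋u e∋v u≢v) nil , k<e ∷ [-]
  walk-between {e} {u = u} ((e<g , x , e∋x , g∋x) ◅ c) e∋u f∋v k<e with u ≟ x
  ... | yes refl = walk-between c g∋x f∋v (ℕ.<-trans k<e e<g)
  ... | no u≢x   =
    let w , t = walk-between c g∋x f∋v e<g
    in step e (endpoint⇒joins G {e} e∋u e∋x u≢x) w , k<e ∷ t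

  -- The end vertex is left free so that `f` can always be traversed, towards its other end; only
  -- earlier edges may be omitted.
  walk-through : ∀ {e f u k} → e ≼ f → Endpoint G e u → k ℕ.< label G e →
    ∃[ v ] Σ[ w ∈ Walk G u v ] (StartsAfter k w × f ∈ edges w)
  walk-through {e} ε e∋u k<e =
    let v , j = opposite G {e} e∋u in v , step e j nil , k<e ∷ [-] , here refl
  walk-through {e} {u = u} ((e<g , x , e∋x , g∋x) ◅ c) e∋u k<e with u ≟ x
  ... | yes refl = walk-through c g∋x (ℕ.<-trans k<e e<g)
  ... | no u≢x   =
    let v , w , t , i = walk-through c g∋x e<g
    in v , step e (endpoint⇒joins G {e} e∋u e∋x u≢x) w , k<e ∷ t , there i

  ≼⇒⇝ : ∀ {e f u v} → Endpoint G e u → Endpoint G f v → e ≼ f → G ⊢ u ⇝ v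
  -- Positivity of labels makes `0` a valid initial bound, which `Linked.tail` then drops.
  ≼⇒⇝ {e} e∋u f∋v c = let w , t = walk-between c e∋u f∋v (label-pos G e) in w , Linked.tail t

  ≼⇒⇝ᵉ : ∀ {v e} → ∃[ f ] (Endpoint G f v × f ≼ e) → G ⊢ v ⇝ᵉ e
  ≼⇒⇝ᵉ (f , f∋v , c) =
    let x , w , t , i = walk-through c f∋v (label-pos G f) in x , w , Linked.tail t , i

  -- To force the traversal of `e`, the walk starts at the end of `e` opposite to where the chain
  -- turns, or opposite to `v` if `e` is the whole chain.
  ≼⇒ᵉ⇝ : ∀ {v e} → ∃[ f ] (Endpoint G f v × e ≼ f) → G ⊢ e ᵉ⇝ v
  ≼⇒ᵉ⇝ {e = e} (_ , e∋v , ε) =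
    let x , j = opposite G {e} e∋v in x , step e (joins-sym G {e} j) nil , [-] , here refl
  ≼⇒ᵉ⇝ {e = e} (_ , f∋v , (e<g , x , e∋x , g∋x) ◅ c) =
    let y , j = opposite G {e} e∋x
        w , t = walk-between c g∋x f∋v e<g
    in y , step e (joins-sym G {e} j) w , t , here refl

  ≼⇒ᵉ⇝ᵉ : ∀ {e f} → e ≼ f → G ⊢ e ᵉ⇝ᵉ f
  ≼⇒ᵉ⇝ᵉ ε = inj₁ refl
  ≼⇒ᵉ⇝ᵉ {e} ((e<g , x , e∋x , g∋x) ◅ c) =
    let y , j = opposite G {e} e∋x
        z , w , t , i = walk-through c g∋x e<g
    in inj₂ (y , z , step e (joins-sym G {e} j) w , t , refl ∷ from∈ i)

-- Deletion of an edge.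

connectedWithout⇒redundant : (G : TemporalGraph n m) → TemporallyConnected G →
  ∀ x → Forward.ConnectedWithout G x → Reachability (G ∖ x) ⇔ Reachability G
connectedWithout⇒redundant {n} {suc m} G tc x connected = (λ _ → tc _ _) , (λ _ → reach _ _)
  where
  restrict : ∀ {e f} → Star (Forward.AvoidingStep G x) e f → ∀ e′ → punchIn x e′ ≡ e →
    ∀ f′ → punchIn x f′ ≡ f → Star (Forward.Step (G ∖ x)) e′ f′
  restrict ε e′ p f′ q = subst (Star _ e′) (punchIn-injective x e′ f′ (trans p (sym q))) ε
  -- Edges of `G ∖ x` inherit ends and label through `punchIn x` by definition, so a step needs no
  -- translation beyond rewriting `g` as `punchIn x g′`.
  restrict ((s , _ , g≢x) ◅ c) e′ refl f′ q =
    let g′ = punchOut (≢-sym g≢x)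
        p = punchIn-punchOut (≢-sym g≢x)
    in subst (Forward.Step G (punchIn x e′)) (sym p) s ◅ restrict c g′ p f′ q

  reach : ∀ u v → G ∖ x ⊢ u ⇝ v
  reach u v =
    let e , f , e∋u , f∋v , e≢x , f≢x , c = connected u v
        p = punchIn-punchOut (≢-sym e≢x)
        q = punchIn-punchOut (≢-sym f≢x)
    in Reachability⇔Chains.≼⇒⇝ (G ∖ x)
         (subst (λ e → Endpoint G e u) (sym p) e∋u)
         (subst (λ f → Endpoint G f v) (sym q) f∋v)
         (restrict c _ p _ q)

-- Divergent and convergent edges of a minimal connected graph.

another : 2 ≤ n → (v : Fin n) → ∃[ w ] v ≢ w
another (s≤s (s≤s _)) v = punchIn v zero , ≢-sym (punchInᵢ≢i v zero)

lemma3p23 : ∀ {n m : ℕ} (G : TemporalGraph n m) → 2 ≤ n →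
    Happy G → Compressed G → TemporallyConnected G → Minimal G →
    (∀ (v : Fin n) → ∃! _≡_ (λ e → Divergent G e × (G ⊢ v ⇝ᵉ e))) ×
    (∀ (v : Fin n) → ∃! _≡_ (λ e → Convergent G e × (G ⊢ e ᵉ⇝ v)))
lemma3p23 {n} {m} G 2≤n happy _ tc minimal =
  (λ v → ∃!-resp
    (λ ((s , max) , r) → (s , λ (f , sf , f≢e , q) → max (f , sf , f≢e , ᵉ⇝ᵉ⇒≼ q)) , ≼⇒⇝ᵉ r)
    (λ ((s , max) , r) → (s , λ (f , sf , f≢e , q) → max (f , sf , f≢e , ≼⇒ᵉ⇝ᵉ q)) , ⇝ᵉ⇒≼ r)
    (F.∃!-maximal connected minimalᶠ source? source-closed source⇒universal
      (λ _ below → universal⇒source (F.first-universal connected below)) v)) ,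
  (λ v → ∃!-resp
    -- A backward chain from `v` up to the maximal edge is a forward chain from that edge to `v`.
    (λ ((s , max) , f , f∋v , c) →
      (s , λ (g , sg , g≢e , q) → max (g , sg , g≢e , to-backward (ᵉ⇝ᵉ⇒≼ q))) ,
      ≼⇒ᵉ⇝ (f , f∋v , to-forward c))
    (λ ((s , max) , r) →
      (s , λ (g , sg , g≢e , q) → max (g , sg , g≢e , ≼⇒ᵉ⇝ᵉ (to-forward q))) ,
      let f , f∋v , c = ᵉ⇝⇒≼ r in f , f∋v , to-backward c)
    (B.∃!-maximal connectedᵇ minimalᵇ divSink? divSink-closed
      (sink⇒universal ∘ proj₁) last⇒divSink v))
  where
  open Reachability⇔Chains G
  open Forward G using (Connected; Universal; _≼_; ConnectedWithout)

  isSPO : IsStrictPartialOrder _≡_ (ℕ._<_ on label G)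
  isSPO = record
    { isEquivalence = isEquivalence
    ; irrefl = λ { refl → ℕ.<-irrefl refl }
    ; trans = ℕ.<-trans
    ; <-resp-≈ = (λ { refl p → p }) , (λ { refl p → p })
    }

  compare : ∀ {v e f} → Endpoint G e v → Endpoint G f v → e ≢ f →
    label G e ℕ.< label G f ⊎ label G f ℕ.< label G e
  compare {v} {e} {f} e∋v f∋v e≢f with ℕ.<-cmp (label G e) (label G f)
  ... | tri< e<f _ _ = inj₁ e<f
  ... | tri≈ _ e≈f _ = contradiction e≈f (happy e f (e≢f , v , e∋v , f∋v))
  ... | tri> _ _ f<e = inj₂ f<e

  module F = Forward.Ordered G isSPO (λ e f → label G e ℕ.<? label G f) compare
  module B = Backward.Ordered G (Flip.isStrictPartialOrder isSPO)
    (λ e f → label G f ℕ.<? label G e) (λ e∋v f∋v → swap ∘ compare e∋v f∋v)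

  to-backward : ∀ {e f} → e ≼ f → Backward._≼_ G f e
  to-backward = reverse λ (e<f , v , e∋v , f∋v) → e<f , v , f∋v , e∋v

  to-forward : ∀ {e f} → Backward._≼_ G e f → f ≼ e
  to-forward = reverse λ (f<e , v , e∋v , f∋v) → f<e , v , f∋v , e∋v

  connected : Connected
  connected u v with u ≟ v
  ... | no u≢v   = ⇝⇒≼ u≢v (tc u v)
  -- The walk from `u` to itself may be empty, so an edge at `u` is taken from a walk to a second
  -- vertex.
  ... | yes refl =
    let w , u≢w = another 2≤n u
        e , _ , e∋u , _ = ⇝⇒≼ u≢w (tc u w)
    in e , e , e∋u , e∋u , ε

  connectedᵇ : Backward.Connected G
  connectedᵇ u v =
    let e , f , e∋v , f∋u , c = connected v u in f , e , f∋u , e∋v , to-backward c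

  minimalᶠ : ∀ x → ¬ ConnectedWithout x
  minimalᶠ x = minimal x ∘ connectedWithout⇒redundant G tc x

  minimalᵇ : ∀ x → ¬ Backward.ConnectedWithout G x
  minimalᵇ x connectedWithout = minimalᶠ x λ u v →
    let e , f , e∋v , f∋u , e≢x , f≢x , c = connectedWithout v u
    in f , e , f∋u , e∋v , f≢x , e≢x ,
       reverse (λ ((f<e , v , e∋v , f∋v) , e≢x , f≢x) → (f<e , v , f∋v , e∋v) , f≢x , e≢x) c

  source⇒universal : ∀ {e} → SourceEdge G e → Universal e
  source⇒universal s v = ᵉ⇝⇒≼ (s v)

  universal⇒source : ∀ {e} → Universal e → SourceEdge G e
  universal⇒source s v = ≼⇒ᵉ⇝ (s v)

  sink⇒universal : ∀ {e} → SinkEdge G e → Backward.Universal G e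
  sink⇒universal s v = let f , f∋v , c = ⇝ᵉ⇒≼ (s v) in f , f∋v , to-backward c

  universal⇒sink : ∀ {e} → Backward.Universal G e → SinkEdge G e
  universal⇒sink s v = let f , f∋v , c = s v in ≼⇒⇝ᵉ (f , f∋v , to-forward c)

  -- The search for a maximal edge needs a decidable family; decidability is inherited from chains.
  _⇝ᵉ?_ : ∀ e f → Dec (G ⊢ e ᵉ⇝ᵉ f)
  e ⇝ᵉ? f = map′ ≼⇒ᵉ⇝ᵉ ᵉ⇝ᵉ⇒≼ (e F.≼? f)

  source? : Unary.Decidable (SourceEdge G)
  source? = map′ universal⇒source source⇒universal ∘ F.universal?

  sink? : Unary.Decidable (SinkEdge G)
  sink? = map′ universal⇒sink sink⇒universal ∘ B.universal?

  divergent? : Unary.Decidable (Divergent G)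
  divergent? e = source? e ×-dec ¬? (any? λ f → source? f ×-dec ¬? (f ≟ e) ×-dec (e ⇝ᵉ? f))

  divSink? : Unary.Decidable (DivSink G)
  divSink? e = sink? e ×-dec all? (λ d → divergent? d →-dec (d ⇝ᵉ? e))

  source-closed : ∀ {e f} → e ≼ f → SourceEdge G f → SourceEdge G e
  source-closed c s v = let g , g∋v , d = ᵉ⇝⇒≼ (s v) in ≼⇒ᵉ⇝ (g , g∋v , c ◅◅ d)

  divSink-closed : ∀ {e f} → Backward._≼_ G e f → DivSink G f → DivSink G e
  divSink-closed c (s , below) =
    (λ v → let g , g∋v , d = ⇝ᵉ⇒≼ (s v) in ≼⇒⇝ᵉ (g , g∋v , d ◅◅ to-forward c)) ,
    (λ d div → ≼⇒ᵉ⇝ᵉ (ᵉ⇝ᵉ⇒≼ (below d div) ◅◅ to-forward c))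

  -- A divergent edge is a source edge, so it reaches some edge at `v`, and from there the last edge
  -- at `v`. This is why div-sink edges exist.
  last⇒divSink : ∀ {v e} → Endpoint G e v → (∀ {f} → Endpoint G f v → Backward._≼_ G e f) →
    DivSink G e
  last⇒divSink {v} _ above =
    universal⇒sink (B.first-universal connectedᵇ above) ,
    λ d (source , _) →
      let f , f∋v , c = ᵉ⇝⇒≼ (source v) in ≼⇒ᵉ⇝ᵉ (c ◅◅ to-forward (above f∋v))
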